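{- For every $n\ge1$, the pairs $(\mathrm{LAC},\mathrm{imaj})$ and $(\mathrm{LAC},\mathrm{inv})$ are equidistributed on $\mathfrak S_n$: for every word $L$ and every integer $m$, $$\#\{\sigma\in\mathfrak S_n:\mathrm{LAC}\,\sigma=L,\ \mathrm{imaj}\,\sigma=m\}=\#\{\sigma\in\mathfrak S_n:\mathrm{LAC}\,\sigma=L,\ \mathrm{inv}\,\sigma=m\}.$$
   Context: For $\sigma\in\mathfrak S_n$: $\mathrm{maj}\,\sigma=\sum i$ over $1\le i\le n-1$ with $\sigma(i)>\sigma(i+1)$; $\mathrm{imaj}\,\sigma=\mathrm{maj}\,\sigma^{ -1}$; $\mathrm{inv}\,\sigma$ is the number of pairs $a<b$ with $\sigma(a)>\sigma(b)$. With the convention $\sigma(n+1)=+\infty$, for each $1\le i\le n$ set $\ell_i=0$ if $\sigma(i)<\sigma(i+1)$, and $\ell_i=k$ if $\sigma(i)$ is greater than all of $\sigma(i+1),\dots,\sigma(i+k)$ but $\sigma(i)<\sigma(i+k+1)$; $\mathrm{LAC}\,\sigma=\ell_1\cdots\ell_n$. -}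

module Defs where

open import Data.Nat using (ℕ; zero; suc; _+_; _<_; _<?_; _≟_)
open import Data.List using (List; []; _∷_; length; map; filter; takeWhile; concatMap; applyUpTo; sum)
open import Data.List.Relation.Unary.Unique.Propositional using (Unique)
open import Data.List.Relation.Unary.All using (All)
open import Data.Product using (_×_)
open import Relation.Nullary using (Dec; yes; no; does)
open import Relation.Nullary.Decidable using (_×-dec_)
open import Relation.Binary.PropositionalEquality using (_≡_)
import Data.List.Relation.Unary.Unique.DecPropositional as UDec
import Data.List.Properties as LP
open import Data.Bool using (if_then_else_)

-- A permutation σ ∈ 𝔖_n is represented in one-line notation as the word
-- σ(1) σ(2) … σ(n) (a List ℕ), with values in {1,…,n}.

words : ℕ → ℕ → List (List ℕ)
words n zero    = [] ∷ []
words n (suc k) = concatMap (λ a → map (a ∷_) (words n k)) (applyUpTo suc n)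

IsPerm : ℕ → List ℕ → Set
IsPerm n σ = (length σ ≡ n) × (All (λ a → 1 Data.Nat.≤ a) σ × All (λ a → a Data.Nat.≤ n) σ) × Unique σ

majFrom : ℕ → List ℕ → ℕ
majFrom i []            = 0
majFrom i (a ∷ [])      = 0
majFrom i (a ∷ b ∷ r)   = (if does (b <? a) then i else 0) + majFrom (suc i) (b ∷ r)

maj : List ℕ → ℕ
maj σ = majFrom 1 σ

-- 1-based position of the first occurrence of j in σ (1 + length σ if absent)
posOf : ℕ → List ℕ → ℕ
posOf j []      = 1
posOf j (a ∷ r) = if does (j ≟ a) then 1 else suc (posOf j r)

inverse : List ℕ → List ℕ
inverse σ = applyUpTo (λ j → posOf (suc j) σ) (length σ)

imaj : List ℕ → ℕ
imaj σ = maj (inverse σ)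

inv : List ℕ → ℕ
inv []      = 0
inv (a ∷ r) = length (filter (_<? a) r) + inv r

-- LAC: ℓ_i = length of the maximal run σ(i+1),…,σ(i+k) of letters smaller
-- than σ(i)  (convention σ(n+1) = +∞, so the run stops at the end)
LAC : List ℕ → List ℕ
LAC []      = []
LAC (a ∷ r) = length (takeWhile (_<? a) r) ∷ LAC r

isPerm? : (n : ℕ) → (σ : List ℕ) → Dec (IsPerm n σ)
isPerm? n σ = (length σ ≟ n) ×-dec ((Data.List.Relation.Unary.All.all? (λ a → 1 Data.Nat.≤? a) σ
               ×-dec Data.List.Relation.Unary.All.all? (λ a → a Data.Nat.≤? n) σ) ×-dec UDec.unique? _≟_ σ)

countLACimaj : ℕ → List ℕ → ℕ → ℕ
countLACimaj n L m = length (filter (λ σ → isPerm? n σ ×-dec (LP.≡-dec _≟_ (LAC σ) L ×-dec (imaj σ ≟ m))) (words n n))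

countLACinv : ℕ → List ℕ → ℕ → ℕ
countLACinv n L m = length (filter (λ σ → isPerm? n σ ×-dec (LP.≡-dec _≟_ (LAC σ) L ×-dec (inv σ ≟ m))) (words n n))

{-# OPTIONS --safe #-}
module Submission where

-- Foata's second fundamental transformation φ turns maj into inv, so the conjugate of φ by
-- σ ↦ σ⁻¹ is an injection of 𝔖_n into itself, hence a bijection, carrying imaj to inv.
-- It preserves LAC: in terms of w = σ⁻¹, LAC records for each i < j whether some letter of
-- the interval (i, j] follows i in w. When φ appends a letter x outside [i, j], the letters
-- of [i, j] are all smaller or all larger than x, and φ keeps the relative order within
-- each of these two classes; when x lies in (i, j], it follows i on both sides as soon as i
-- has occurred.

open import Defs
open import Data.Nat using (ℕ; zero; suc; _+_; _≤_; _<_; _<?_; _≤?_; _≟_; z≤n; s≤s; s<s; z<s)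
open import Data.Nat.ListAction using (sum)
open import Data.Nat.ListAction.Properties using (sum-↭)
open import Data.Nat.Properties
open import Data.Nat.Solver using (module +-*-Solver)
open import Data.Bool using (Bool; true; false; _∧_; if_then_else_)
open import Data.Bool.Properties using (∧-comm)
open import Data.Empty using (⊥)
open import Data.List using (List; []; _∷_; length; filter; map; reverse; applyUpTo; takeWhile; _∷ʳ_; _++_)
open import Data.List.Properties
open import Data.List.Membership.Propositional using (_∈_; _∉_)
open import Data.List.Membership.Propositional.Properties
open import Data.List.Relation.Binary.Permutation.Propositional using (_↭_; ↭-refl; ↭-sym; ↭-trans; ↭-reflexive; prep; swap; ↭⇒↭ₛ)
open import Data.List.Relation.Binary.Permutation.Propositional.Properties using (↭-length; filter-↭; ∈-resp-↭; All-resp-↭; ↭-reverse; shift) renaming (map⁺ to ↭-map⁺)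
import Data.List.Relation.Binary.Permutation.Setoid.Properties as ↭ₛ
open import Data.List.Relation.Unary.All as All using (All; []; _∷_)
import Data.List.Relation.Unary.All.Properties as All
open import Data.List.Relation.Unary.AllPairs as AllPairs using (AllPairs; []; _∷_)
import Data.List.Relation.Unary.AllPairs.Properties as AllPairs
open import Data.List.Relation.Unary.Any using (here; there)
open import Data.List.Relation.Unary.Unique.Propositional using (Unique)
import Data.List.Relation.Unary.Unique.Propositional.Properties as Unique
open import Data.Product using (_×_; _,_; proj₂; ∃; map₂)
open import Data.Sum as Sum using (_⊎_; inj₁; inj₂)
open import Function using (_∘_; id; _on_; _⇔_; mk⇔; Equivalence)
open import Level using (0ℓ)
open import Relation.Binary.Definitions using (tri<; tri≈; tri>)
open import Relation.Binary.PropositionalEquality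
open import Relation.Nullary using (¬_; Dec; does; yes; no; contradiction)
open import Relation.Nullary.Decidable using (dec-true; dec-false; _×-dec_)
open import Relation.Unary using (Pred; Decidable)

-- Foata's transformation and its injectivity

-- Words are read from right to left, so that appending a letter is _∷_. A block of Foata's
-- factorisation is then a letter satisfying P followed by letters that do not, and carry
-- moves the leading letter of each block to the end of its block; c is the leading letter
-- of the current block.
carry : {P : Pred ℕ 0ℓ} → Decidable P → ℕ → List ℕ → List ℕ
carry P? c []      = c ∷ []
carry P? c (z ∷ w) with P? z
... | yes _ = c ∷ carry P? z w
... | no  _ = z ∷ carry P? c w

-- The head `c` is the last letter of the word, and its side of `x` decides which letters lead the
-- blocks. In the second branch `c < x` as soon as `x` does not occur in the word.
rotate : ℕ → List ℕ → List ℕ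
rotate x []      = []
rotate x (c ∷ w) with x <? c
... | yes _ = carry (x <?_) c w
... | no  _ = carry (_<? x) c w

foata : List ℕ → List ℕ
foata []      = []
foata (x ∷ w) = x ∷ rotate x (foata w)

carry-↭ : {P : Pred ℕ 0ℓ} (P? : Decidable P) → ∀ c w → carry P? c w ↭ c ∷ w
carry-↭ P? c []      = ↭-refl
carry-↭ P? c (z ∷ w) with P? z
... | yes _ = prep c (carry-↭ P? z w)
... | no  _ = ↭-trans (prep z (carry-↭ P? c w)) (swap z c ↭-refl)

rotate-↭ : ∀ x w → rotate x w ↭ w
rotate-↭ x []      = ↭-refl
rotate-↭ x (c ∷ w) with x <? c
... | yes _ = carry-↭ (x <?_) c w
... | no  _ = carry-↭ (_<? x) c w

foata-↭ : ∀ w → foata w ↭ w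
foata-↭ []      = ↭-refl
foata-↭ (x ∷ w) = prep x (↭-trans (rotate-↭ x (foata w)) (foata-↭ w))

carry≢[] : {P : Pred ℕ 0ℓ} (P? : Decidable P) → ∀ c w → carry P? c w ≢ []
carry≢[] P? c w eq with () ← trans (sym (↭-length (carry-↭ P? c w))) (cong length eq)

-- The pending letter satisfies `P`, so the head of the output satisfies `P` exactly when the next
-- input letter does. Hence the input can be decoded from left to right.
carry-injective : {P : Pred ℕ 0ℓ} (P? : Decidable P) → ∀ {c d} v w → P c → P d →
                  carry P? c v ≡ carry P? d w → c ∷ v ≡ d ∷ w
carry-injective P? [] [] Pc Pd eq = eq
carry-injective P? {c} {d} [] (z ∷ w) Pc Pd eq with P? z
... | yes _ = contradiction (sym (∷-injectiveʳ eq)) (carry≢[] P? z w)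
... | no  _ = contradiction (sym (∷-injectiveʳ eq)) (carry≢[] P? d w)
carry-injective P? {c} {d} (y ∷ v) [] Pc Pd eq with P? y
... | yes _ = contradiction (∷-injectiveʳ eq) (carry≢[] P? y v)
... | no  _ = contradiction (∷-injectiveʳ eq) (carry≢[] P? c v)
carry-injective P? (y ∷ v) (z ∷ w) Pc Pd eq with P? y | P? z
... | yes Py | yes Pz = cong₂ _∷_ (∷-injectiveˡ eq) (carry-injective P? v w Py Pz (∷-injectiveʳ eq))
... | yes Py | no ¬Pz = contradiction (subst _ (∷-injectiveˡ eq) Pc) ¬Pz
... | no ¬Py | yes Pz = contradiction (subst _ (sym (∷-injectiveˡ eq)) Pd) ¬Py
... | no ¬Py | no ¬Pz with carry-injective P? v w Pc Pd (∷-injectiveʳ eq)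
...   | refl = cong (λ t → _ ∷ t ∷ _) (∷-injectiveˡ eq)

-- The two words differ in their last letter, which satisfies P on the left and Q on the right.
carry-disjoint : {P Q : Pred ℕ 0ℓ} (P? : Decidable P) (Q? : Decidable Q) → (∀ {z} → P z → ¬ Q z) →
                 ∀ {c d} v w → P c → Q d → carry P? c v ≢ carry Q? d w
carry-disjoint P? Q? P⇒¬Q [] [] Pc Qd refl = P⇒¬Q Pc Qd
carry-disjoint P? Q? P⇒¬Q {c} {d} [] (z ∷ w) Pc Qd eq with Q? z
... | yes _ = carry≢[] Q? z w (sym (∷-injectiveʳ eq))
... | no  _ = carry≢[] Q? d w (sym (∷-injectiveʳ eq))
carry-disjoint P? Q? P⇒¬Q {c} (y ∷ v) [] Pc Qd eq with P? y
... | yes _ = carry≢[] P? y v (∷-injectiveʳ eq)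
... | no  _ = carry≢[] P? c v (∷-injectiveʳ eq)
carry-disjoint P? Q? P⇒¬Q (y ∷ v) (z ∷ w) Pc Qd eq with P? y | Q? z
... | yes Py | yes Qz = carry-disjoint P? Q? P⇒¬Q v w Py Qz (∷-injectiveʳ eq)
... | yes Py | no  _  = carry-disjoint P? Q? P⇒¬Q v w Py Qd (∷-injectiveʳ eq)
... | no  _  | yes Qz = carry-disjoint P? Q? P⇒¬Q v w Pc Qz (∷-injectiveʳ eq)
... | no  _  | no  _  = carry-disjoint P? Q? P⇒¬Q v w Pc Qd (∷-injectiveʳ eq)

≮∧≢⇒> : ∀ {x c} → ¬ c < x → x ≢ c → x < c
≮∧≢⇒> c≮x x≢c = ≤∧≢⇒< (≮⇒≥ c≮x) x≢c

-- The final entry of the image lies on the same side of `x` as the head of the argument, so the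
-- image tells which branch was taken.
rotate-injective : ∀ {x} v w → All (x ≢_) v → All (x ≢_) w → rotate x v ≡ rotate x w → v ≡ w
rotate-injective []      []      _ _ _ = refl
rotate-injective {x} [] (d ∷ w) _ _ eq with () ← trans (cong length eq) (↭-length (rotate-↭ x (d ∷ w)))
rotate-injective {x} (c ∷ v) [] _ _ eq with () ← trans (cong length (sym eq)) (↭-length (rotate-↭ x (c ∷ v)))
rotate-injective {x} (c ∷ v) (d ∷ w) (x≢c ∷ _) (x≢d ∷ _) eq with x <? c | x <? d
... | yes x<c | yes x<d = carry-injective (x <?_) v w x<c x<d eq
... | yes x<c | no  x≮d = contradiction eq (carry-disjoint (x <?_) (_<? x) <-asym v w x<c (≮∧≢⇒> x≮d (≢-sym x≢d)))
... | no  x≮c | yes x<d = contradiction eq (carry-disjoint (_<? x) (x <?_) <-asym v w (≮∧≢⇒> x≮c (≢-sym x≢c)) x<d)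
... | no  x≮c | no  x≮d = carry-injective (_<? x) v w (≮∧≢⇒> x≮c (≢-sym x≢c)) (≮∧≢⇒> x≮d (≢-sym x≢d)) eq

foata-All : ∀ {P : Pred ℕ 0ℓ} {w} → All P w → All P (foata w)
foata-All {w = w} = All-resp-↭ (↭-sym (foata-↭ w))

foata-injective : ∀ {v w} → Unique v → Unique w → foata v ≡ foata w → v ≡ w
foata-injective {[]}    {[]}    _ _ _ = refl
foata-injective {x ∷ v} {y ∷ w} (x∉v ∷ uv) (y∉w ∷ uw) eq with ∷-injective eq
... | refl , eq′ = cong (x ∷_) (foata-injective uv uw
                     (rotate-injective (foata v) (foata w) (foata-All x∉v) (foata-All y∉w) eq′))

-- The statistics inv and maj

above below : ℕ → List ℕ → ℕ
above x w = length (filter (x <?_) w)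
below x w = length (filter (_<? x) w)

above-↭ : ∀ x {v w} → v ↭ w → above x v ≡ above x w
above-↭ x p = ↭-length (filter-↭ (x <?_) p)

above-accept : ∀ {x z} w → x < z → above x (z ∷ w) ≡ suc (above x w)
above-accept {x} w x<z = cong length (filter-accept (x <?_) x<z)

above-reject : ∀ {x z} w → ¬ x < z → above x (z ∷ w) ≡ above x w
above-reject {x} w x≮z = cong length (filter-reject (x <?_) x≮z)

below-accept : ∀ {x z} w → z < x → below x (z ∷ w) ≡ suc (below x w)
below-accept {x} w z<x = cong length (filter-accept (_<? x) z<x)

below-reject : ∀ {x z} w → ¬ z < x → below x (z ∷ w) ≡ below x w
below-reject {x} w z≮x = cong length (filter-reject (_<? x) z≮x)

above+below : ∀ {x w} → All (x ≢_) w → above x w + below x w ≡ length w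
above+below [] = refl
above+below {x} {z ∷ w} (x≢z ∷ x∉w) with z <? x
... | yes z<x rewrite above-reject w (<-asym z<x) | below-accept w z<x = trans (+-suc _ _) (cong suc (above+below x∉w))
... | no  z≮x rewrite above-accept w (≮∧≢⇒> z≮x x≢z) | below-reject w z≮x = cong suc (above+below x∉w)

-- The head is the last letter of the word, so `above x w` counts the inversions closed by `x`.
invʳ : List ℕ → ℕ
invʳ []      = 0
invʳ (x ∷ w) = above x w + invʳ w

-- What an appended `x` adds to the major index: the letter `y` before it stands at position
-- `suc (length w)`.
descent : ℕ → List ℕ → ℕ
descent x []      = 0
descent x (y ∷ w) = if does (x <? y) then suc (length w) else 0

descent-accept : ∀ {x y} w → x < y → descent x (y ∷ w) ≡ suc (length w)
descent-accept {x} {y} w x<y = cong (if_then suc (length w) else 0) (dec-true (x <? y) x<y)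

descent-reject : ∀ {x y} w → ¬ x < y → descent x (y ∷ w) ≡ 0
descent-reject {x} {y} w x≮y = cong (if_then suc (length w) else 0) (dec-false (x <? y) x≮y)

majʳ : List ℕ → ℕ
majʳ []      = 0
majʳ (x ∷ w) = descent x w + majʳ w

open +-*-Solver

-- Each letter above `x` is passed by the smaller leading letter of its block, which undoes exactly
-- one inversion.
invʳ-carry-below : ∀ {x c} w → c < x → All (x ≢_) w →
                   invʳ (carry (_<? x) c w) + above x w ≡ invʳ (c ∷ w)
invʳ-carry-below [] _ _ = refl
invʳ-carry-below {x} {c} (z ∷ w) c<x (x≢z ∷ x∉w) with z <? x
... | yes z<x rewrite above-reject w (<-asym z<x) | above-↭ c (carry-↭ (_<? x) z w)
  = trans (+-assoc (above c (z ∷ w)) _ _) (cong (above c (z ∷ w) +_) (invʳ-carry-below w z<x x∉w))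
... | no  z≮x rewrite above-accept w (≮∧≢⇒> z≮x x≢z) | above-↭ z (carry-↭ (_<? x) c w)
                    | above-accept w (<-trans c<x (≮∧≢⇒> z≮x x≢z))
                    | above-reject {z} {c} w (λ z<c → z≮x (<-trans z<c c<x))
  = trans (solve 3 (λ a b d → a :+ b :+ (con 1 :+ d) := con 1 :+ a :+ (b :+ d)) refl
             (above z w) (invʳ (carry (_<? x) c w)) (above x w))
   (trans (cong (suc (above z w) +_) (invʳ-carry-below w c<x x∉w))
          (solve 3 (λ a b d → con 1 :+ a :+ (b :+ d) := con 1 :+ b :+ (a :+ d)) refl
             (above z w) (above c w) (invʳ w)))

-- Here each letter below `x` is passed by a larger leading letter, which creates exactly one
-- inversion.
invʳ-carry-above : ∀ {x c} w → x < c → All (x ≢_) w →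
                   invʳ (carry (x <?_) c w) ≡ invʳ (c ∷ w) + below x w
invʳ-carry-above [] _ _ = refl
invʳ-carry-above {x} {c} (z ∷ w) x<c (x≢z ∷ x∉w) with x <? z
... | yes x<z rewrite below-reject w (<-asym x<z) | above-↭ c (carry-↭ (x <?_) z w)
  = trans (cong (above c (z ∷ w) +_) (invʳ-carry-above w x<z x∉w))
          (sym (+-assoc (above c (z ∷ w)) _ _))
... | no  x≮z with ≮∧≢⇒> x≮z (≢-sym x≢z)
...   | z<x rewrite below-accept w z<x | above-↭ z (carry-↭ (x <?_) c w)
                  | above-accept w (<-trans z<x x<c)
                  | above-reject {c} {z} w (<-asym (<-trans z<x x<c))
  = trans (cong (suc (above z w) +_) (invʳ-carry-above w x<c x∉w))
          (solve 4 (λ a b d e → con 1 :+ a :+ (b :+ d :+ e) := b :+ (a :+ d) :+ (con 1 :+ e)) refl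
             (above z w) (above c w) (invʳ w) (below x w))

-- If `c < x`, the inversions closed by `x` make up for those undone by the rotation. If `x < c`,
-- the `suc (above x w)` inversions closed by `x` and the `below x w` created by the rotation add up
-- to the position of the new descent.
invʳ-∷-rotate : ∀ {x} w → All (x ≢_) w → invʳ (x ∷ rotate x w) ≡ descent x w + invʳ w
invʳ-∷-rotate []      _ = refl
invʳ-∷-rotate {x} (c ∷ w) (x≢c ∷ x∉w) with x <? c
... | no  x≮c rewrite above-↭ x (carry-↭ (_<? x) c w) | above-reject w x≮c | descent-reject w x≮c
  = trans (+-comm (above x w) _) (invʳ-carry-below w (≮∧≢⇒> x≮c (≢-sym x≢c)) x∉w)
... | yes x<c rewrite above-↭ x (carry-↭ (x <?_) c w) | above-accept w x<c
                    | descent-accept w x<c | invʳ-carry-above w x<c x∉w | sym (above+below x∉w)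
  = solve 3 (λ a b d → con 1 :+ a :+ (b :+ d) := con 1 :+ (a :+ d) :+ b) refl
      (above x w) (invʳ (c ∷ w)) (below x w)

-- Only the head and the length matter, and `foata` keeps both.
descent-foata : ∀ x w → descent x (foata w) ≡ descent x w
descent-foata x []      = refl
descent-foata x (y ∷ w) = cong (λ k → if does (x <? y) then suc k else 0)
  (trans (↭-length (rotate-↭ y (foata w))) (↭-length (foata-↭ w)))

invʳ-foata : ∀ {w} → Unique w → invʳ (foata w) ≡ majʳ w
invʳ-foata [] = refl
invʳ-foata {x ∷ w} (x∉w ∷ uw) =
  trans (invʳ-∷-rotate (foata w) (foata-All x∉w)) (cong₂ _+_ (descent-foata x w) (invʳ-foata uw))

-- Order relative to a fixed letter under Foata's transformation

-- The letter satisfying `P` is nearer to the head of the list, and so comes after `i` in the word.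
Precedes : Pred ℕ 0ℓ → ℕ → List ℕ → Set
Precedes P i []      = ⊥
Precedes P i (x ∷ w) = (P x × i ∈ w) ⊎ Precedes P i w

Precedes⇒∈ : ∀ {P i} w → Precedes P i w → i ∈ w
Precedes⇒∈ (x ∷ w) (inj₁ (_ , i∈w)) = there i∈w
Precedes⇒∈ (x ∷ w) (inj₂ p)         = there (Precedes⇒∈ w p)

module _ {M : Pred ℕ 0ℓ} (M? : Decidable M) {P : Pred ℕ 0ℓ} {i : ℕ}
         (M-agree : ∀ {k} → P k → M k ⇔ M i) where
  open Equivalence

  -- `carry` only exchanges a letter satisfying `M` with one that does not, whereas by `M-agree`
  -- every letter satisfying `P` is on the same side of `M` as `i`. So no such letter ever passes
  -- `i`.
  Precedes-carry⁺ : ∀ {c} w → M c → Precedes P i (c ∷ w) → Precedes P i (carry M? c w)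
  Precedes-carry⁺ [] Mc p = p
  Precedes-carry⁺ {c} (z ∷ w) Mc p with M? z
  Precedes-carry⁺ {c} (z ∷ w) Mc (inj₁ (Pc , i∈)) | yes Mz = inj₁ (Pc , ∈-resp-↭ (↭-sym (carry-↭ M? z w)) i∈)
  Precedes-carry⁺ {c} (z ∷ w) Mc (inj₂ p)         | yes Mz = inj₂ (Precedes-carry⁺ w Mz p)
  -- The one exchange that would spoil the order has `z` equal to `i`.
  Precedes-carry⁺ {c} (z ∷ w) Mc (inj₁ (Pc , here refl)) | no ¬Mz = contradiction (to (M-agree Pc) Mc) ¬Mz
  Precedes-carry⁺ {c} (z ∷ w) Mc (inj₁ (Pc , there i∈))  | no ¬Mz = inj₂ (Precedes-carry⁺ w Mc (inj₁ (Pc , i∈)))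
  Precedes-carry⁺ {c} (z ∷ w) Mc (inj₂ (inj₁ (Pz , i∈))) | no ¬Mz = inj₁ (Pz , ∈-resp-↭ (↭-sym (carry-↭ M? c w)) (there i∈))
  Precedes-carry⁺ {c} (z ∷ w) Mc (inj₂ (inj₂ p))         | no ¬Mz = inj₂ (Precedes-carry⁺ w Mc (inj₂ p))

  Precedes-carry⁻ : ∀ {c} w → M c → Precedes P i (carry M? c w) → Precedes P i (c ∷ w)
  Precedes-carry⁻ [] Mc p = p
  Precedes-carry⁻ {c} (z ∷ w) Mc p with M? z
  Precedes-carry⁻ {c} (z ∷ w) Mc (inj₁ (Pc , i∈)) | yes Mz = inj₁ (Pc , ∈-resp-↭ (carry-↭ M? z w) i∈)
  Precedes-carry⁻ {c} (z ∷ w) Mc (inj₂ p)         | yes Mz = inj₂ (Precedes-carry⁻ w Mz p)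
  Precedes-carry⁻ {c} (z ∷ w) Mc (inj₁ (Pz , i∈)) | no ¬Mz with ∈-resp-↭ (carry-↭ M? c w) i∈
  ... | here refl = contradiction (from (M-agree Pz) Mc) ¬Mz
  ... | there i∈w = inj₂ (inj₁ (Pz , i∈w))
  Precedes-carry⁻ {c} (z ∷ w) Mc (inj₂ p) | no ¬Mz = Sum.map (map₂ there) inj₂ (Precedes-carry⁻ w Mc p)

Within : ℕ → ℕ → Pred ℕ 0ℓ
Within i j k = i < k × k ≤ j

module _ {i j : ℕ} where

  -- A letter outside the closed interval from `i` to `j` cannot separate two members of it.
  >-agree : ∀ {x} → x < i ⊎ j < x → ∀ {k} → Within i j k → (x < k) ⇔ (x < i)
  >-agree (inj₁ x<i) (i<k , k≤j) = mk⇔ (λ _ → x<i) (λ _ → <-trans x<i i<k)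
  >-agree (inj₂ j<x) (i<k , k≤j) = mk⇔ (λ x<k → contradiction (<-≤-trans x<k k≤j) (<-asym j<x))
                                       (λ x<i → <-trans x<i i<k)

  <-agree : ∀ {x} → x < i ⊎ j < x → ∀ {k} → Within i j k → (k < x) ⇔ (i < x)
  <-agree (inj₁ x<i) (i<k , k≤j) = mk⇔ (<-trans i<k) (λ i<x → contradiction i<x (<-asym x<i))
  <-agree (inj₂ j<x) (i<k , k≤j) = mk⇔ (<-trans i<k) (λ _ → ≤-<-trans k≤j j<x)

  Precedes-rotate : ∀ {x} w → All (x ≢_) w → x < i ⊎ j < x →
                    Precedes (Within i j) i (rotate x w) ⇔ Precedes (Within i j) i w
  Precedes-rotate [] _ _ = mk⇔ id id
  Precedes-rotate {x} (c ∷ w) (x≢c ∷ _) out with x <? c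
  ... | yes x<c = mk⇔ (Precedes-carry⁻ (x <?_) (>-agree out) w x<c) (Precedes-carry⁺ (x <?_) (>-agree out) w x<c)
  ... | no  x≮c = mk⇔ (Precedes-carry⁻ (_<? x) (<-agree out) w c<x) (Precedes-carry⁺ (_<? x) (<-agree out) w c<x)
    where c<x = ≮∧≢⇒> x≮c (≢-sym x≢c)

  position : ∀ x → (x < i ⊎ j < x) ⊎ x ≡ i ⊎ Within i j x
  position x with <-cmp x i | x ≤? j
  ... | tri< x<i _ _ | _       = inj₁ (inj₁ x<i)
  ... | tri≈ _ x≡i _ | _       = inj₂ (inj₁ x≡i)
  ... | tri> _ _ i<x | yes x≤j = inj₂ (inj₂ (i<x , x≤j))
  ... | tri> _ _ i<x | no  x≰j = inj₁ (inj₂ (≰⇒> x≰j))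

  -- An `x` in the interval is itself the letter sought once `i` has occurred, and `x` equal to `i`
  -- would be a repetition; only an outside `x` needs `f`. Two words `v` and `w` appear so that
  -- `Precedes-foata` can use this in both directions.
  Precedes-∷ : ∀ {x v w} → v ↭ w → x ∉ w →
               (x < i ⊎ j < x → Precedes (Within i j) i v → Precedes (Within i j) i w) →
               Precedes (Within i j) i (x ∷ v) → Precedes (Within i j) i (x ∷ w)
  Precedes-∷ v↭w x∉w f (inj₁ (Px , i∈v)) = inj₁ (Px , ∈-resp-↭ v↭w i∈v)
  Precedes-∷ {x} {v} v↭w x∉w f (inj₂ p) with position x
  ... | inj₁ out         = inj₂ (f out p)
  ... | inj₂ (inj₁ refl) = contradiction (∈-resp-↭ v↭w (Precedes⇒∈ v p)) x∉w
  ... | inj₂ (inj₂ Px)   = inj₁ (Px , ∈-resp-↭ v↭w (Precedes⇒∈ v p))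

  Precedes-foata : ∀ {w} → Unique w → Precedes (Within i j) i (foata w) ⇔ Precedes (Within i j) i w
  Precedes-foata [] = mk⇔ id id
  Precedes-foata {x ∷ w} u@(x∉w ∷ uw) = mk⇔
    (Precedes-∷ ρ x∉ (λ out → to (Precedes-foata uw) ∘ to (rot out)))
    (Precedes-∷ (↭-sym ρ) (x∉ ∘ ∈-resp-↭ ρ) (λ out → from (rot out) ∘ from (Precedes-foata uw)))
    where
    open Equivalence
    ρ   = ↭-trans (rotate-↭ x (foata w)) (foata-↭ w)
    x∉  = Unique.Unique[x∷xs]⇒x∉xs u
    rot : x < i ⊎ j < x → _
    rot = Precedes-rotate (foata w) (foata-All x∉w)

-- Positions of letters

posOf-here : ∀ x l → posOf x (x ∷ l) ≡ 1
posOf-here x l = cong (if_then 1 else suc (posOf x l)) (dec-true (x ≟ x) refl)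

posOf-there : ∀ {x y} l → x ≢ y → posOf y (x ∷ l) ≡ suc (posOf y l)
posOf-there {x} {y} l x≢y = cong (if_then 1 else suc (posOf y l)) (dec-false (y ≟ x) (≢-sym x≢y))

-- A view of membership that follows the first occurrence, as `posOf` does, and carries the equation
-- for `posOf`; a bare proof of `x ∈ l` may point to a later occurrence.
data Occurs (x : ℕ) : List ℕ → Set where
  now   : ∀ {l} → posOf x (x ∷ l) ≡ 1 → Occurs x (x ∷ l)
  later : ∀ {y l} → posOf x (y ∷ l) ≡ suc (posOf x l) → x ∈ l → Occurs x (y ∷ l)

occurs : ∀ {x l} → x ∈ l → Occurs x l
occurs {x} {y ∷ l} x∈ with x ≟ y
occurs {x} {y ∷ l} x∈          | yes refl = now (posOf-here x l)
occurs {x} {y ∷ l} (here x≡y)  | no x≢y = contradiction x≡y x≢y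
occurs {x} {y ∷ l} (there x∈l) | no x≢y = later (posOf-there l (≢-sym x≢y)) x∈l

posOf≤length : ∀ {x l} → x ∈ l → posOf x l ≤ length l
posOf≤length x∈ with occurs x∈
... | now eq       = subst (_≤ _) (sym eq) (s≤s z≤n)
... | later eq x∈l = subst (_≤ _) (sym eq) (s≤s (posOf≤length x∈l))

1≤posOf : ∀ x l → 1 ≤ posOf x l
1≤posOf x []      = s≤s z≤n
1≤posOf x (y ∷ l) with y ≟ x
... | yes refl = ≤-reflexive (sym (posOf-here x l))
... | no  y≢x  = subst (1 ≤_) (sym (posOf-there l y≢x)) (s≤s z≤n)

posOf-injective : ∀ {x y l} → x ∈ l → y ∈ l → posOf x l ≡ posOf y l → x ≡ y
posOf-injective {x} {y} x∈ y∈ eq with occurs x∈ | occurs y∈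
... | now _             | now _        = refl
... | now {l} p         | later q _    = contradiction (suc-injective (trans (trans (sym q) (sym eq)) p)) (>⇒≢ (1≤posOf y l))
... | later {l = l} p _ | now q        = contradiction (suc-injective (trans (trans (sym p) eq) q)) (>⇒≢ (1≤posOf x l))
... | later p x∈l       | later q y∈l  = posOf-injective x∈l y∈l (suc-injective (trans (trans (sym p) eq) q))

posOf-∷ʳ-∈ : ∀ {x l} y → x ∈ l → posOf x (l ∷ʳ y) ≡ posOf x l
posOf-∷ʳ-∈ {x} {z ∷ l} y x∈ with z ≟ x
posOf-∷ʳ-∈ {x} {z ∷ l} y x∈          | yes refl = trans (posOf-here x (l ∷ʳ y)) (sym (posOf-here x l))
posOf-∷ʳ-∈ {x} {z ∷ l} y (here x≡z)  | no z≢x   = contradiction (sym x≡z) z≢x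
posOf-∷ʳ-∈ {x} {z ∷ l} y (there x∈l) | no z≢x   =
  trans (posOf-there (l ∷ʳ y) z≢x) (trans (cong suc (posOf-∷ʳ-∈ y x∈l)) (sym (posOf-there l z≢x)))

posOf-∷ʳ-∉ : ∀ {x} l → x ∉ l → posOf x (l ∷ʳ x) ≡ suc (length l)
posOf-∷ʳ-∉ {x} [] _ = posOf-here x []
posOf-∷ʳ-∉ {x} (z ∷ l) x∉ = trans (posOf-there (l ∷ʳ x) (λ z≡x → x∉ (here (sym z≡x))))
                                  (cong suc (posOf-∷ʳ-∉ l (x∉ ∘ there)))

∈-reverse : ∀ {x : ℕ} {v} → x ∈ v → x ∈ reverse v
∈-reverse {v = v} = ∈-resp-↭ (↭-sym (↭-reverse v))

posOf-reverse-∈ : ∀ {x v} y → x ∈ v → posOf x (reverse (y ∷ v)) ≡ posOf x (reverse v)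
posOf-reverse-∈ {x} {v} y x∈v = trans (cong (posOf x) (unfold-reverse y v)) (posOf-∷ʳ-∈ y (∈-reverse x∈v))

posOf-reverse-∉ : ∀ {x v} → x ∉ v → posOf x (reverse (x ∷ v)) ≡ suc (length v)
posOf-reverse-∉ {x} {v} x∉v = trans (cong (posOf x) (unfold-reverse x v))
  (trans (posOf-∷ʳ-∉ (reverse v) (x∉v ∘ ∈-resp-↭ (↭-reverse v))) (cong suc (length-reverse v)))

posOf-reverse≤ : ∀ {x v} → x ∈ v → posOf x (reverse v) ≤ length v
posOf-reverse≤ {x} {v} x∈v = subst (posOf x (reverse v) ≤_) (length-reverse v) (posOf≤length (∈-reverse x∈v))

-- The head of `v` is last in `reverse v`, so its position exceeds all the others, and these do not
-- change when it is appended.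
Precedes⇒posOf< : ∀ {P i v} → Unique v → Precedes P i v →
                  ∃ λ k → P k × k ∈ v × posOf i (reverse v) < posOf k (reverse v)
Precedes⇒posOf< {v = x ∷ v} u (inj₁ (Px , i∈v)) = x , Px , here refl ,
  subst₂ _<_ (sym (posOf-reverse-∈ x i∈v)) (sym (posOf-reverse-∉ (Unique.Unique[x∷xs]⇒x∉xs u))) (s≤s (posOf-reverse≤ i∈v))
Precedes⇒posOf< {v = x ∷ v} (_ ∷ u) (inj₂ p) with Precedes⇒posOf< u p
... | k , Pk , k∈v , i<k = k , Pk , there k∈v ,
  subst₂ _<_ (sym (posOf-reverse-∈ x (Precedes⇒∈ v p))) (sym (posOf-reverse-∈ x k∈v)) i<k

posOf<⇒Precedes : ∀ {P : Pred ℕ 0ℓ} {i k v} → Unique v → i ∈ v → k ∈ v → P k →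
                  posOf i (reverse v) < posOf k (reverse v) → Precedes P i v
posOf<⇒Precedes u (here refl) (here refl) Pk i<k = contradiction i<k (<-irrefl refl)
posOf<⇒Precedes u (there i∈v) (here refl) Pk i<k = inj₁ (Pk , i∈v)
posOf<⇒Precedes {v = x ∷ v} u (here refl) (there k∈v) Pk i<k = contradiction
  (subst₂ _<_ (posOf-reverse-∉ (Unique.Unique[x∷xs]⇒x∉xs u)) (posOf-reverse-∈ x k∈v) i<k)
  (≤⇒≯ (m≤n⇒m≤1+n (posOf-reverse≤ k∈v)))
posOf<⇒Precedes {v = x ∷ v} (_ ∷ u) (there i∈v) (there k∈v) Pk i<k =
  inj₂ (posOf<⇒Precedes u i∈v k∈v Pk (subst₂ _<_ (posOf-reverse-∈ x i∈v) (posOf-reverse-∈ x k∈v) i<k))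

-- Reading LAC off the inverse permutation

-- For `i < j` and `g` listing the letters from index 0, this says that the entry of `LAC` at `i` is
-- at least `j - i`.
Dominates : (ℕ → ℕ) → ℕ → ℕ → Set
Dominates g i j = ∀ k → i < k → k ≤ j → g k < g i

module _ {P : Pred ℕ 0ℓ} (P? : Decidable P) where

  takeWhile-accept : ∀ {x} l → P x → takeWhile P? (x ∷ l) ≡ x ∷ takeWhile P? l
  takeWhile-accept {x} l Px with P? x
  ... | yes _  = refl
  ... | no ¬Px = contradiction Px ¬Px

  takeWhile-reject : ∀ {x} l → ¬ P x → takeWhile P? (x ∷ l) ≡ []
  takeWhile-reject {x} l ¬Px with P? x
  ... | yes Px = contradiction Px ¬Px
  ... | no _   = refl

-- The length is the number of indices `j` below `n` such that all entries up to `j` pass the test.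
takeWhile-applyUpTo-cong : ∀ {a b} (g h : ℕ → ℕ) n →
  (∀ j → j < n → (∀ k → k ≤ j → g k < a) ⇔ (∀ k → k ≤ j → h k < b)) →
  length (takeWhile (_<? a) (applyUpTo g n)) ≡ length (takeWhile (_<? b) (applyUpTo h n))
takeWhile-applyUpTo-cong g h zero    _ = refl
takeWhile-applyUpTo-cong {a} {b} g h (suc n) eqv with g 0 <? a | h 0 <? b
... | no  g≮a | no  h≮b rewrite takeWhile-reject (_<? a) (applyUpTo (g ∘ suc) n) g≮a
                              | takeWhile-reject (_<? b) (applyUpTo (h ∘ suc) n) h≮b = refl
... | yes g<a | no  h≮b = contradiction (Equivalence.to (eqv 0 z<s) (λ { .0 z≤n → g<a }) 0 z≤n) h≮b
... | no  g≮a | yes h<b = contradiction (Equivalence.from (eqv 0 z<s) (λ { .0 z≤n → h<b }) 0 z≤n) g≮a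
... | yes g<a | yes h<b rewrite takeWhile-accept (_<? a) (applyUpTo (g ∘ suc) n) g<a
                              | takeWhile-accept (_<? b) (applyUpTo (h ∘ suc) n) h<b =
  -- A prefix of the tail is extended by index 0, where the test is known to succeed.
  cong suc (takeWhile-applyUpTo-cong (g ∘ suc) (h ∘ suc) n λ j j<n →
    let open Equivalence (eqv (suc j) (s<s j<n)) in
    mk⇔ (λ p k k≤j → to   (λ { zero _ → g<a ; (suc k) (s≤s k≤j) → p k k≤j }) (suc k) (s≤s k≤j))
        (λ p k k≤j → from (λ { zero _ → h<b ; (suc k) (s≤s k≤j) → p k k≤j }) (suc k) (s≤s k≤j)))

LAC-applyUpTo-cong : ∀ g h n → (∀ {i j} → i < j → j < n → Dominates g i j ⇔ Dominates h i j) →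
                     LAC (applyUpTo g n) ≡ LAC (applyUpTo h n)
LAC-applyUpTo-cong g h zero    _   = refl
LAC-applyUpTo-cong g h (suc n) eqv = cong₂ _∷_
  (takeWhile-applyUpTo-cong (g ∘ suc) (h ∘ suc) n λ j j<n →
    let open Equivalence (eqv {0} {suc j} z<s (s<s j<n)) in
    mk⇔ (λ p k k≤j → to   (λ { (suc k) _ (s≤s k≤j) → p k k≤j }) (suc k) z<s (s≤s k≤j))
        (λ p k k≤j → from (λ { (suc k) _ (s≤s k≤j) → p k k≤j }) (suc k) z<s (s≤s k≤j)))
  (LAC-applyUpTo-cong (g ∘ suc) (h ∘ suc) n λ {i} {j} i<j j<n →
    let open Equivalence (eqv {suc i} {suc j} (s<s i<j) (s<s j<n)) in
    mk⇔ (λ p k i<k k≤j → to   (λ { (suc k) (s<s i<k) (s≤s k≤j) → p k i<k k≤j }) (suc k) (s<s i<k) (s≤s k≤j))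
        (λ p k i<k k≤j → from (λ { (suc k) (s<s i<k) (s≤s k≤j) → p k i<k k≤j }) (suc k) (s<s i<k) (s≤s k≤j)))

iota : ℕ → List ℕ
iota = applyUpTo suc

iota-unique : ∀ n → Unique (iota n)
iota-unique n = Unique.applyUpTo⁺₁ suc n (λ i<j _ → <⇒≢ (s<s i<j))

Unique-resp-↭ : {A : Set} {v w : List A} → v ↭ w → Unique v → Unique w
Unique-resp-↭ {A} = ↭ₛ.Unique-resp-↭ (setoid A) ∘ ↭⇒↭ₛ

-- A failure of `Dominates` is a letter of the interval placed after `suc i`, which is what
-- `Precedes` expresses. Hence the implication between the words is reversed.
Dominates-mono : ∀ {n v w} → v ↭ iota n → w ↭ iota n → ∀ {i j} → i < j → j < n →
                 (Precedes (Within (suc i) (suc j)) (suc i) w → Precedes (Within (suc i) (suc j)) (suc i) v) →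
                 Dominates (λ k → posOf (suc k) (reverse v)) i j → Dominates (λ k → posOf (suc k) (reverse w)) i j
Dominates-mono {n} {v} {w} v↭ w↭ {i} {j} i<j j<n w⇒v dom k i<k k≤j = ≰⇒> λ i≤k →
  let i∈ = ∈-resp-↭ (↭-sym w↭) (∈-applyUpTo⁺ suc (<-trans i<j j<n))
      k∈ = ∈-resp-↭ (↭-sym w↭) (∈-applyUpTo⁺ suc (≤-<-trans k≤j j<n))
      -- Distinct letters have distinct positions, so the failed inequality is strict the other way.
      i<k′ = ≤∧≢⇒< i≤k (λ eq → <⇒≢ i<k (suc-injective (posOf-injective (∈-reverse i∈) (∈-reverse k∈) eq)))
  in absurd (Precedes⇒posOf< (unique v↭) (w⇒v (posOf<⇒Precedes (unique w↭) i∈ k∈ (s<s i<k , s≤s k≤j) i<k′)))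
  where
  unique : ∀ {u} → u ↭ iota n → Unique u
  unique u↭ = Unique-resp-↭ (↭-sym u↭) (iota-unique n)
  absurd : ¬ ∃ λ k → Within (suc i) (suc j) k × k ∈ v × posOf (suc i) (reverse v) < posOf k (reverse v)
  absurd (suc k , (s<s i<k , s≤s k≤j) , _ , i<k′) = <-asym i<k′ (dom k i<k k≤j)

LAC-inverse-foata : ∀ {n v} → v ↭ iota n → LAC (inverse (reverse (foata v))) ≡ LAC (inverse (reverse v))
LAC-inverse-foata {n} {v} v↭ rewrite length-reverse (foata v) | length-reverse v
                                    | ↭-length (foata-↭ v) | ↭-length v↭ | length-applyUpTo suc n =
  LAC-applyUpTo-cong _ _ n λ i<j j<n → mk⇔
    (Dominates-mono φ↭ v↭ i<j j<n (from (Precedes-foata u)))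
    (Dominates-mono v↭ φ↭ i<j j<n (to (Precedes-foata u)))
  where
  open Equivalence
  φ↭ = ↭-trans (foata-↭ v) v↭
  u  = Unique-resp-↭ (↭-sym v↭) (iota-unique n)

-- `inv` and `maj` of a reversed word

inv-∷ʳ : ∀ l x → inv (l ∷ʳ x) ≡ above x l + inv l
inv-∷ʳ []      x = refl
inv-∷ʳ (a ∷ l) x rewrite filter-++ (_<? a) l (x ∷ []) | length-++ (filter (_<? a) l) {filter (_<? a) (x ∷ [])}
                       | inv-∷ʳ l x with x <? a
... | yes x<a rewrite above-accept l x<a | below-accept [] x<a =
  solve 3 (λ b c d → b :+ con 1 :+ (c :+ d) := con 1 :+ c :+ (b :+ d)) refl (below a l) (above x l) (inv l)
... | no  x≮a rewrite above-reject l x≮a | below-reject [] x≮a =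
  solve 3 (λ b c d → b :+ con 0 :+ (c :+ d) := c :+ (b :+ d)) refl (below a l) (above x l) (inv l)

inv-reverse : ∀ v → inv (reverse v) ≡ invʳ v
inv-reverse []      = refl
inv-reverse (x ∷ v) rewrite unfold-reverse x v | inv-∷ʳ (reverse v) x =
  cong₂ _+_ (above-↭ x (↭-reverse v)) (inv-reverse v)

-- The only new adjacent pair is the last one, and with numbering from `i` the letter `y` has
-- position `i + length l`.
majFrom-∷ʳ : ∀ i l y x → majFrom i (l ∷ʳ y ∷ʳ x) ≡ (if does (x <? y) then i + length l else 0) + majFrom i (l ∷ʳ y)
majFrom-∷ʳ i []          y x = cong (λ k → (if does (x <? y) then k else 0) + 0) (sym (+-identityʳ i))
majFrom-∷ʳ i (a ∷ [])    y x rewrite +-comm i 1 =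
  solve 2 (λ b c → b :+ (c :+ con 0) := c :+ (b :+ con 0)) refl
    (if does (y <? a) then i else 0) (if does (x <? y) then suc i else 0)
majFrom-∷ʳ i (a ∷ b ∷ l) y x rewrite majFrom-∷ʳ (suc i) (b ∷ l) y x | +-suc i (suc (length l)) =
  solve 3 (λ b c d → b :+ (c :+ d) := c :+ (b :+ d)) refl
    (if does (b <? a) then i else 0) (if does (x <? y) then suc (i + suc (length l)) else 0)
    (majFrom (suc i) (b ∷ l ∷ʳ y))

maj-reverse : ∀ v → maj (reverse v) ≡ majʳ v
maj-reverse []          = refl
maj-reverse (x ∷ [])    = refl
maj-reverse (x ∷ y ∷ v) = begin
  maj (reverse (x ∷ y ∷ v))                                                    ≡⟨ cong maj (unfold-reverse x (y ∷ v)) ⟩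
  maj (reverse (y ∷ v) ∷ʳ x)                                                   ≡⟨ cong (λ l → maj (l ∷ʳ x)) (unfold-reverse y v) ⟩
  maj (reverse v ∷ʳ y ∷ʳ x)                                                    ≡⟨ majFrom-∷ʳ 1 (reverse v) y x ⟩
  (if does (x <? y) then suc (length (reverse v)) else 0) + maj (reverse v ∷ʳ y)
    ≡⟨ cong₂ (λ k l → (if does (x <? y) then suc k else 0) + maj l) (length-reverse v)
             (sym (unfold-reverse y v)) ⟩
  descent x (y ∷ v) + maj (reverse (y ∷ v))                                    ≡⟨ cong (descent x (y ∷ v) +_) (maj-reverse (y ∷ v)) ⟩
  descent x (y ∷ v) + majʳ (y ∷ v)                                             ∎
  where open ≡-Reasoning

-- Inverse permutations

-- Without repetitions, every place of `σ` is the first occurrence of its letter.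
map-posOf : ∀ {σ} → Unique σ → map (λ x → posOf x σ) σ ≡ iota (length σ)
map-posOf [] = refl
map-posOf {x ∷ σ} (x∉σ ∷ u) = cong₂ _∷_ (posOf-here x σ)
  (trans (map-cong-local (All.map (posOf-there σ) x∉σ))
  (trans (map-∘ σ)
  (trans (cong (map suc) (map-posOf u)) (map-applyUpTo suc suc (length σ)))))

posOf-map : ∀ {f : ℕ → ℕ} {l x} → (∀ {y z} → y ∈ l → z ∈ l → f y ≡ f z → y ≡ z) → x ∈ l →
            posOf (f x) (map f l) ≡ posOf x l
posOf-map {f} {y ∷ l} {x} inj x∈ with y ≟ x
posOf-map {f} {y ∷ l} {x} inj x∈          | yes refl = trans (posOf-here (f x) (map f l)) (sym (posOf-here x l))
posOf-map {f} {y ∷ l} {x} inj (here x≡y)  | no  y≢x  = contradiction (sym x≡y) y≢x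
posOf-map {f} {y ∷ l} {x} inj (there x∈l) | no  y≢x  =
  trans (posOf-there (map f l) (y≢x ∘ inj (here refl) (there x∈l)))
  (trans (cong suc (posOf-map (λ p q → inj (there p) (there q)) x∈l)) (sym (posOf-there l y≢x)))

-- `map-posOf` for `iota n` itself says that taking positions fixes every entry.
posOf-iota : ∀ {n x} → x ∈ iota n → posOf x (iota n) ≡ x
posOf-iota {n} x∈ with ∈-applyUpTo⁻ suc x∈
... | i , i<n , refl = All.applyUpTo⁻ suc n fixed i<n
  where
  fixed : All (λ x → posOf x (iota n) ≡ x) (iota n)
  fixed = map-fixed (iota n) (trans (map-posOf (iota-unique n)) (cong iota (length-applyUpTo suc n)))
    where
    map-fixed : ∀ {f : ℕ → ℕ} l → map f l ≡ l → All (λ x → f x ≡ x) l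
    map-fixed []      _  = []
    map-fixed (x ∷ l) eq = ∷-injectiveˡ eq ∷ map-fixed l (∷-injectiveʳ eq)

module _ {n σ} (σ↭ : σ ↭ iota n) where

  perm-length : length σ ≡ n
  perm-length = trans (↭-length σ↭) (length-applyUpTo suc n)

  perm-unique : Unique σ
  perm-unique = Unique-resp-↭ (↭-sym σ↭) (iota-unique n)

  map-posOf-perm : map (λ x → posOf x σ) σ ≡ iota n
  map-posOf-perm = trans (map-posOf perm-unique) (cong iota perm-length)

  inverse-map : inverse σ ≡ map (λ x → posOf x σ) (iota n)
  inverse-map = trans (cong (applyUpTo _) perm-length) (sym (map-applyUpTo suc _ n))

  inverse-↭ : inverse σ ↭ iota n
  inverse-↭ = ↭-trans (↭-reflexive inverse-map)
             (↭-trans (↭-map⁺ _ (↭-sym σ↭)) (↭-reflexive map-posOf-perm))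

-- The indices `iota n` are rewritten as the positions of the letters of `σ`. Relabelling by
-- positions then turns the place of `posOf x σ` in the inverse into that of `x` in `iota n`, which
-- is `x`.
inverse-involutive : ∀ {n σ} → σ ↭ iota n → inverse (inverse σ) ≡ σ
inverse-involutive {n} {σ} σ↭ = begin
  inverse (inverse σ)                          ≡⟨ inverse-map (inverse-↭ σ↭) ⟩
  map (λ x → posOf x (inverse σ)) (iota n)     ≡⟨ cong (map _) (map-posOf-perm σ↭) ⟨
  map (λ x → posOf x (inverse σ)) (map p σ)    ≡⟨ map-∘ σ ⟨
  map (λ x → posOf (p x) (inverse σ)) σ        ≡⟨ map-cong-local (All.tabulate λ x∈σ →
      trans (cong (posOf _) (inverse-map σ↭))
     (trans (posOf-map (λ y∈ z∈ → posOf-injective (∈-resp-↭ (↭-sym σ↭) y∈) (∈-resp-↭ (↭-sym σ↭) z∈)) (∈-resp-↭ σ↭ x∈σ))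
            (posOf-iota (∈-resp-↭ σ↭ x∈σ)))) ⟩
  map id σ                                     ≡⟨ map-id σ ⟩
  σ                                            ∎
  where
  open ≡-Reasoning
  p = λ x → posOf x σ

-- Inversions of the inverse permutation

∑ : (ℕ → ℕ) → List ℕ → ℕ
∑ f l = sum (map f l)

∑-cong : ∀ {f g : ℕ → ℕ} → (∀ x → f x ≡ g x) → ∀ l → ∑ f l ≡ ∑ g l
∑-cong eq l = cong sum (map-cong eq l)

∑-zero : ∀ {f : ℕ → ℕ} {l} → All (λ x → f x ≡ 0) l → ∑ f l ≡ 0
∑-zero []        = refl
∑-zero (eq ∷ eqs) rewrite eq = ∑-zero eqs

∑-+ : ∀ (f g : ℕ → ℕ) l → ∑ (λ x → f x + g x) l ≡ ∑ f l + ∑ g l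
∑-+ f g []      = refl
∑-+ f g (x ∷ l) rewrite ∑-+ f g l =
  solve 4 (λ a b c d → a :+ b :+ (c :+ d) := a :+ c :+ (b :+ d)) refl (f x) (g x) (∑ f l) (∑ g l)

∑-swap : ∀ (F : ℕ → ℕ → ℕ) l m → ∑ (λ x → ∑ (F x) m) l ≡ ∑ (λ y → ∑ (λ x → F x y) l) m
∑-swap F []      m = sym (∑-zero {l = m} (All.tabulate (λ _ → refl)))
∑-swap F (x ∷ l) m rewrite ∑-swap F l m = sym (∑-+ (F x) (λ y → ∑ (λ x → F x y) l) m)

∑-↭ : ∀ f {l m} → l ↭ m → ∑ f l ≡ ∑ f m
∑-↭ f p = sum-↭ (↭-map⁺ f p)

indicator : Bool → ℕ
indicator b = if b then 1 else 0

-- A symmetric form of inversion: `f` and `g` order the two letters oppositely.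
crossing : (f g : ℕ → ℕ) → ℕ → ℕ → ℕ
crossing f g x y = indicator (does (f x <? f y) ∧ does (g y <? g x))

crossings : (f g : ℕ → ℕ) → List ℕ → ℕ
crossings f g l = ∑ (λ x → ∑ (crossing f g x) l) l

-- Exchanging `f` and `g` amounts to exchanging the two summation variables.
crossings-sym : ∀ f g l → crossings f g l ≡ crossings g f l
crossings-sym f g l = trans (∑-swap (crossing f g) l l)
  (∑-cong (λ y → ∑-cong (λ x → cong indicator (∧-comm (does (f x <? f y)) _)) l) l)

crossings-↭ : ∀ f g {l m} → l ↭ m → crossings f g l ≡ crossings f g m
crossings-↭ f g {l} {m} p = trans (∑-cong (λ x → ∑-↭ (crossing f g x) p) l) (∑-↭ _ p)

crossing-≮ : ∀ f g {x y} → ¬ f x < f y → crossing f g x y ≡ 0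
crossing-≮ f g {x} {y} fx≮fy rewrite dec-false (f x <? f y) fx≮fy = refl

below-map : ∀ f g {x} l → All (λ y → f x < f y) l → below (g x) (map g l) ≡ ∑ (crossing f g x) l
below-map f g []      []           = refl
below-map f g {x} (y ∷ l) (fx<fy ∷ h) rewrite dec-true (f x <? f y) fx<fy with g y <? g x
... | yes gy<gx rewrite dec-true (g y <? g x) gy<gx = cong suc (below-map f g l h)
... | no  gy≮gx rewrite dec-false (g y <? g x) gy≮gx = below-map f g l h

-- As `l` increases along `f`, the diagonal and the pairs taken against the list order contribute
-- nothing to the double sum.
inv-map : ∀ f g {l} → AllPairs (_<_ on f) l → inv (map g l) ≡ crossings f g l
inv-map f g []            = refl
inv-map f g {x ∷ l} (h ∷ hs)
  rewrite crossing-≮ f g {x} {x} (<-irrefl refl)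
        | ∑-+ (λ y → crossing f g y x) (λ y → ∑ (crossing f g y) l) l
        | ∑-zero (All.map (λ fx<fy → crossing-≮ f g (<-asym fx<fy)) h)
  = cong₂ _+_ (below-map f g l h) (inv-map f g hs)

-- Both sides count the pairs of letters whose values and positions are ordered oppositely: `iota n`
-- lists the letters by value, `σ` by position.
inv-inverse : ∀ {n σ} → σ ↭ iota n → inv (inverse σ) ≡ inv σ
inv-inverse {n} {σ} σ↭ = begin
  inv (inverse σ)         ≡⟨ cong inv (inverse-map σ↭) ⟩
  inv (map p (iota n))    ≡⟨ inv-map id p (AllPairs.applyUpTo⁺₁ suc n (λ i<j _ → s<s i<j)) ⟩
  crossings id p (iota n) ≡⟨ crossings-sym id p (iota n) ⟩
  crossings p id (iota n) ≡⟨ crossings-↭ p id σ↭ ⟨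
  crossings p id σ        ≡⟨ inv-map p id (AllPairs.map⁻ (subst (AllPairs _<_) (sym (map-posOf-perm σ↭))
                                                     (AllPairs.applyUpTo⁺₁ suc n (λ i<j _ → s<s i<j)))) ⟨
  inv (map id σ)          ≡⟨ cong inv (map-id σ) ⟩
  inv σ                   ∎
  where
  open ≡-Reasoning
  p = λ x → posOf x σ

-- Counting

-- Pigeonhole: the entries of `xs` are cut out of `ys` one by one, and the length bound leaves no
-- remainder.
unique-⊆⇒↭ : {A : Set} {xs ys : List A} → Unique xs → (∀ {x} → x ∈ xs → x ∈ ys) →
             length ys ≤ length xs → xs ↭ ys
unique-⊆⇒↭ {ys = []}    []  _ _ = ↭-refl
unique-⊆⇒↭ {A} {xs = x ∷ xs} u@(_ ∷ uxs) xs⊆ys len with ∈-∃++ (xs⊆ys (here refl))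
... | as , bs , refl = ↭-trans (prep x (unique-⊆⇒↭ uxs xs⊆ (≤-pred (subst (_≤ _) (↭-length (shift x as bs)) len))))
                               (↭-sym (shift x as bs))
  where
  xs⊆ : ∀ {y} → y ∈ xs → y ∈ as ++ bs
  xs⊆ y∈xs with ∈-resp-↭ (shift x as bs) (xs⊆ys (there y∈xs))
  ... | here refl = contradiction y∈xs (Unique.Unique[x∷xs]⇒x∉xs u)
  ... | there y∈  = y∈

unique-map : {A : Set} {f : A → A} {xs : List A} → (∀ {x y} → x ∈ xs → y ∈ xs → f x ≡ f y → x ≡ y) →
             Unique xs → Unique (map f xs)
unique-map inj []       = []
unique-map inj (x∉ ∷ u) =
  All.map⁺ (All.tabulate λ y∈ eq → All.lookup x∉ y∈ (inj (here refl) (there y∈) eq)) ∷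
  unique-map (λ p q → inj (there p) (there q)) u

words-unique : ∀ n k → Unique (words n k)
words-unique n zero    = [] ∷ []
words-unique n (suc k) = Unique.concat⁺
  (All.map⁺ (All.tabulate λ _ → Unique.map⁺ ∷-injectiveʳ (words-unique n k)))
  (AllPairs.map⁺ (AllPairs.map disjoint (iota-unique n)))
  where
  disjoint : ∀ {a b} → a ≢ b → ∀ {w} → ¬ (w ∈ map (a ∷_) (words n k) × w ∈ map (b ∷_) (words n k))
  disjoint a≢b (p , q) with ∈-map⁻ _ p | ∈-map⁻ _ q
  ... | _ , _ , refl | _ , _ , eq = a≢b (∷-injectiveˡ eq)

∈-words : ∀ {n w} → All (_∈ iota n) w → w ∈ words n (length w)
∈-words []        = here refl
∈-words (x∈ ∷ w∈) = ∈-concat⁺′ (∈-map⁺ _ (∈-words w∈)) (∈-map⁺ _ x∈)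

∈-iota⁺ : ∀ {n x} → 1 ≤ x → x ≤ n → x ∈ iota n
∈-iota⁺ (s≤s _) x≤n = ∈-applyUpTo⁺ suc x≤n

IsPerm⇒↭ : ∀ {n σ} → IsPerm n σ → σ ↭ iota n
IsPerm⇒↭ {n} (len , (lo , hi) , u) = unique-⊆⇒↭ u
  (λ x∈ → ∈-iota⁺ (All.lookup lo x∈) (All.lookup hi x∈))
  (≤-reflexive (trans (length-applyUpTo suc n) (sym len)))

↭⇒IsPerm : ∀ {n σ} → σ ↭ iota n → IsPerm n σ
↭⇒IsPerm {n} σ↭ = perm-length σ↭ ,
  (All-resp-↭ (↭-sym σ↭) (All.applyUpTo⁺₁ suc n (λ _ → s≤s z≤n)) , All-resp-↭ (↭-sym σ↭) (All.applyUpTo⁺₁ suc n id)) ,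
  perm-unique σ↭

perms : ℕ → List (List ℕ)
perms n = filter (isPerm? n) (words n n)

perms-unique : ∀ n → Unique (perms n)
perms-unique n = Unique.filter⁺ (isPerm? n) (words-unique n n)

∈-perms⁺ : ∀ {n σ} → σ ↭ iota n → σ ∈ perms n
∈-perms⁺ {n} {σ} σ↭ = ∈-filter⁺ (isPerm? n)
  (subst (λ k → σ ∈ words n k) (perm-length σ↭) (∈-words (All.tabulate (∈-resp-↭ σ↭)))) (↭⇒IsPerm σ↭)

∈-perms⁻ : ∀ {n σ} → σ ∈ perms n → σ ↭ iota n
∈-perms⁻ {n} σ∈ = IsPerm⇒↭ (proj₂ (∈-filter⁻ (isPerm? n) {xs = words n n} σ∈))

-- The bijection carrying `imaj` to `inv`

-- The two uses of `reverse` pass between one-line notation and the right-to-left reading of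
-- `foata`.
transfer : List ℕ → List ℕ
transfer σ = inverse (reverse (foata (reverse (inverse σ))))

module _ {n σ} (σ↭ : σ ↭ iota n) where

  private
    v↭ : reverse (inverse σ) ↭ iota n
    v↭ = ↭-trans (↭-reverse _) (inverse-↭ σ↭)

    w↭ : reverse (foata (reverse (inverse σ))) ↭ iota n
    w↭ = ↭-trans (↭-reverse _) (↭-trans (foata-↭ _) v↭)

  transfer-↭ : transfer σ ↭ iota n
  transfer-↭ = inverse-↭ w↭

  -- Recovers the image under `foata` from `transfer σ`, for `transfer-injective`.
  foata-reverse-inverse : foata (reverse (inverse σ)) ≡ reverse (inverse (transfer σ))
  foata-reverse-inverse = trans (sym (reverse-involutive _)) (cong reverse (sym (inverse-involutive w↭)))

  -- `LAC-inverse-foata` applies because `σ` is the inverse of its inverse, reversed twice.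
  LAC-transfer : LAC (transfer σ) ≡ LAC σ
  LAC-transfer = trans (LAC-inverse-foata v↭)
    (cong LAC (trans (cong inverse (reverse-involutive (inverse σ))) (inverse-involutive σ↭)))

  inv-transfer : inv (transfer σ) ≡ imaj σ
  inv-transfer = begin
    inv (transfer σ)                         ≡⟨ inv-inverse w↭ ⟩
    inv (reverse (foata (reverse (inverse σ)))) ≡⟨ inv-reverse (foata (reverse (inverse σ))) ⟩
    invʳ (foata (reverse (inverse σ)))       ≡⟨ invʳ-foata (perm-unique v↭) ⟩
    majʳ (reverse (inverse σ))               ≡⟨ maj-reverse (reverse (inverse σ)) ⟨
    maj (reverse (reverse (inverse σ)))      ≡⟨ cong maj (reverse-involutive (inverse σ)) ⟩
    imaj σ                                   ∎
    where open ≡-Reasoning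

transfer-injective : ∀ {n σ τ} → σ ↭ iota n → τ ↭ iota n → transfer σ ≡ transfer τ → σ ≡ τ
transfer-injective {n} {σ} {τ} σ↭ τ↭ eq = begin
  σ                   ≡⟨ inverse-involutive σ↭ ⟨
  inverse (inverse σ) ≡⟨ cong inverse (reverse-injective {x = inverse σ} {y = inverse τ} (foata-injective (unique σ↭) (unique τ↭)
                           (trans (foata-reverse-inverse σ↭)
                           (trans (cong (reverse ∘ inverse) eq) (sym (foata-reverse-inverse τ↭)))))) ⟩
  inverse (inverse τ) ≡⟨ inverse-involutive τ↭ ⟩
  τ                   ∎
  where
  open ≡-Reasoning
  unique : ∀ {ρ} → ρ ↭ iota n → Unique (reverse (inverse ρ))
  unique ρ↭ = perm-unique (↭-trans (↭-reverse _) (inverse-↭ ρ↭))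

-- An injection of a finite set into itself is a bijection.
map-transfer-↭ : ∀ n → map transfer (perms n) ↭ perms n
map-transfer-↭ n = unique-⊆⇒↭
  (unique-map (λ σ∈ τ∈ → transfer-injective {n} (∈-perms⁻ σ∈) (∈-perms⁻ τ∈)) (perms-unique n))
  (λ τ∈ → let σ , σ∈ , eq = ∈-map⁻ transfer τ∈ in subst (_∈ perms n) (sym eq) (∈-perms⁺ (transfer-↭ {n} (∈-perms⁻ σ∈))))
  (≤-reflexive (sym (length-map transfer (perms n))))

-- Splits off the test for permutations, so that both counts become filters of `perms n`.
filter-×-dec : {A : Set} {P Q : Pred A 0ℓ} (P? : Decidable P) (Q? : Decidable Q) → ∀ xs →
               filter (λ x → P? x ×-dec Q? x) xs ≡ filter Q? (filter P? xs)
filter-×-dec P? Q? []       = refl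
filter-×-dec P? Q? (x ∷ xs) with P? x
... | no  _ = filter-×-dec P? Q? xs
... | yes _ with Q? x
...   | yes _ = cong (x ∷_) (filter-×-dec P? Q? xs)
...   | no  _ = filter-×-dec P? Q? xs

length-filter-map : {A B : Set} {P : Pred B 0ℓ} {Q : Pred A 0ℓ} (P? : Decidable P) (Q? : Decidable Q) (f : A → B) →
                    ∀ {xs} → All (λ x → does (P? (f x)) ≡ does (Q? x)) xs →
                    length (filter P? (map f xs)) ≡ length (filter Q? xs)
length-filter-map P? Q? f [] = refl
length-filter-map P? Q? f {x ∷ xs} (eq ∷ eqs) rewrite eq with does (Q? x)
... | true  = cong suc (length-filter-map P? Q? f eqs)
... | false = length-filter-map P? Q? f eqs

theorem7p2 : (n : ℕ) → 1 ≤ n → (L : List ℕ) → (m : ℕ) → countLACimaj n L m ≡ countLACinv n L m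
theorem7p2 n _ L m = begin
  countLACimaj n L m                                ≡⟨ cong length (filter-×-dec (isPerm? n) imaj? (words n n)) ⟩
  -- On `perms n`, testing `σ` with `imaj` is testing `transfer σ` with `inv`; next, `transfer` only
  -- permutes `perms n`.
  length (filter imaj? (perms n))                   ≡⟨ length-filter-map inv? imaj? transfer (All.tabulate agree) ⟨
  length (filter inv? (map transfer (perms n)))     ≡⟨ ↭-length (filter-↭ inv? (map-transfer-↭ n)) ⟩
  length (filter inv? (perms n))                    ≡⟨ cong length (filter-×-dec (isPerm? n) inv? (words n n)) ⟨
  countLACinv n L m                                 ∎
  where
  open ≡-Reasoning
  imaj? inv? : ∀ σ → Dec _
  imaj? σ = ≡-dec _≟_ (LAC σ) L ×-dec (imaj σ ≟ m)
  inv?  σ = ≡-dec _≟_ (LAC σ) L ×-dec (inv σ ≟ m)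
  agree : ∀ {σ} → σ ∈ perms n → does (inv? (transfer σ)) ≡ does (imaj? σ)
  agree σ∈ = cong₂ (λ l k → does (≡-dec _≟_ l L ×-dec (k ≟ m))) (LAC-transfer {n} σ↭) (inv-transfer {n} σ↭)
    where σ↭ = ∈-perms⁻ {n} σ∈
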